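{- Let $n\ge 2$ and let $D$ be a digital $n$-object in $\mathbb{C}_n$. Then the number $g_{n-2}$ of $(n-2)$-gaps of $D$ is $$g_{n-2} = (n-1)\,c_{n-1}^* - c_{n-2}^*,$$ where $c_{n-1}^*$ and $c_{n-2}^*$ are the numbers of free $(n-1)$-cells and free $(n-2)$-cells of $D$, respectively.
   Context: A cell of $\mathbb{R}^n$ is a product $e=\prod_{j=1}^n I_j$ where, for each $j$, $I_j$ is either a closed interval $[x_j-\frac12,x_j+\frac12]$ or a singleton $\{x_j\pm\frac12\}$, with $x_j\in\mathbb{Z}$. Its dimension $\dim(e)$ is the number of non-degenerate factors. $\mathbb{C}_n^{(i)}$ is the set of all $i$-cells (cells of dimension $i$) and $\mathbb{C}_n=\bigcup_{i=0}^n\mathbb{C}_n^{(i)}$. An $n$-cell is called an $n$-voxel. We say $e_1$ bounds $e_2$ (or $e_2$ is bounded by $e_1$), written $e_1<e_2$, if $e_1\subseteq e_2$ and $\dim(e_1)<\dim(e_2)$. A digital $n$-object $D$ is a finite collection of $n$-voxels. Its $i$-cells are the $i$-cells contained in at least one voxel of $D$. For an $i$-cell $e$ with $0\le i\le n-1$, the $i$-block $B_i(e)$ is the collection of all $n$-voxels $v$ with $e<v$ (there are $2^{n-i}$ of them). An $i$-cell $e$ of $D$ is free if not all voxels of $B_i(e)$ belong to $D$. $c_i^*$ denotes the number of free $i$-cells of $D$. Two distinct $n$-voxels $v_1,v_2$ are strictly $i$-adjacent if $v_1\cap v_2$ is an $i$-cell. For an $i$-cell $e$ ($0\le i\le n-2$),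 $D$ has an $i$-gap over $e$ (and $e$ is called an $i$-hub) if the set of voxels of $B_i(e)$ not belonging to $D$ consists of exactly two voxels $v_1,v_2$, which are strictly $i$-adjacent with $v_1\cap v_2=e$. $g_i$ is the number of $i$-gaps of $D$, i.e. the number of $i$-cells $e$ over which $D$ has an $i$-gap. -}

module Defs where

open import Data.Empty using (⊥)
open import Data.Fin using (Fin)
open import Data.Integer using (ℤ)
open import Data.List using (List; length)
open import Data.List.Membership.Propositional using (_∈_)
open import Data.List.Membership.Propositional.Properties.WithK using (unique∧set⇒bag)
open import Data.List.Relation.Binary.BagAndSetEquality using (∼bag⇒↭)
open import Data.List.Relation.Binary.Permutation.Propositional.Properties using (↭-length)
open import Data.List.Relation.Unary.All using (All)
open import Data.List.Relation.Unary.Unique.Propositional using (Unique)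
open import Data.Nat as ℕ using (ℕ; zero; suc)
open import Data.Product using (_×_; _,_; ∃; ∃-syntax)
open import Data.Rational as ℚ using (ℚ; ½; 1ℚ; _<_; _/_)
import Data.Rational.Properties as ℚ
open import Data.Sum using (_⊎_; inj₁; inj₂)
open import Data.Vec using (Vec; []; _∷_; lookup)
open import Data.Vec.Functional using (Vector)
open import Function.Bundles using (_⇔_; Equivalence)
open import Level using (Level; 0ℓ)
open import Relation.Binary.Definitions using (tri<; tri≈; tri>)
open import Relation.Binary.PropositionalEquality using (_≡_; _≢_; refl)
open import Relation.Nullary using (¬_)
open import Relation.Unary using (Pred; _⊆_; _∩_; _≐_; ∁)

-- Two-sided Dedekind cuts.
record ℝ : Set₁ where
  field
    Lower Upper : Pred ℚ 0ℓ
    lower-inhabited : ∃ Lower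
    upper-inhabited : ∃ Upper
    lower-closed  : ∀ {p q} → p < q → Lower q → Lower p
    upper-closed  : ∀ {p q} → p < q → Upper p → Upper q
    lower-rounded : ∀ {p} → Lower p → ∃[ q ] (p < q × Lower q)
    upper-rounded : ∀ {q} → Upper q → ∃[ p ] (p < q × Upper p)
    disjoint : ∀ {p} → Lower p → Upper p → ⊥
    located  : ∀ {p q} → p < q → Lower p ⊎ Upper q

infix 4 _≤_ _≃_

_≤_ : ℝ → ℝ → Set
x ≤ y = ℝ.Lower x ⊆ ℝ.Lower y

_≃_ : ℝ → ℝ → Set
x ≃ y = x ≤ y × y ≤ x

fromℚ : ℚ → ℝ
fromℚ r = record
  { Lower           = _< r
  ; Upper           = r <_
  ; lower-inhabited = r ℚ.- 1ℚ , r-1<r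
  ; upper-inhabited = r ℚ.+ 1ℚ , r<r+1
  ; lower-closed    = ℚ.<-trans
  ; upper-closed    = λ p<q r<p → ℚ.<-trans r<p p<q
  ; lower-rounded   = ℚ.<-dense
  ; upper-rounded   = λ r<q → let m , r<m , m<q = ℚ.<-dense r<q in m , m<q , r<m
  ; disjoint        = ℚ.<-asym
  ; located         = cut
  }
  where
  r-1<r : r ℚ.- 1ℚ < r
  r-1<r = ℚ.<-respʳ-≡ (ℚ.+-identityʳ r) (ℚ.+-monoʳ-< r (ℚ.negative⁻¹ (ℚ.- 1ℚ)))

  r<r+1 : r < r ℚ.+ 1ℚ
  r<r+1 = ℚ.<-respˡ-≡ (ℚ.+-identityʳ r) (ℚ.+-monoʳ-< r (ℚ.positive⁻¹ 1ℚ))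

  cut : ∀ {p q} → p < q → p < r ⊎ r < q
  cut {p} {q} p<q with ℚ.<-cmp p r
  ... | tri< p<r _ _    = inj₁ p<r
  ... | tri≈ _ refl _   = inj₂ p<q
  ... | tri> _ _ r<p    = inj₂ (ℚ.<-trans r<p p<q)

-- As x ranges over ℤ, the points x + ½ are exactly the points x ± ½; using
-- only the sign + gives each possible factor, hence each cell, a unique
-- code, so that cells can be compared and counted up to _≡_.
data Factor : Set where
  interval  : ℤ → Factor   -- [ x - ½ , x + ½ ]
  singleton : ℤ → Factor   -- { x + ½ }

⟦_⟧ᶠ : Factor → Pred ℝ 0ℓ
⟦ interval x ⟧ᶠ  t = fromℚ (x / 1 ℚ.- ½) ≤ t × t ≤ fromℚ (x / 1 ℚ.+ ½)
⟦ singleton x ⟧ᶠ t = t ≃ fromℚ (x / 1 ℚ.+ ½)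

Cell : ℕ → Set
Cell n = Vec Factor n

⟦_⟧ : ∀ {n} → Cell n → Pred (Vector ℝ n) 0ℓ
⟦ e ⟧ p = ∀ j → ⟦ lookup e j ⟧ᶠ (p j)

dim : ∀ {n} → Cell n → ℕ
dim []                = zero
dim (interval _  ∷ e) = suc (dim e)
dim (singleton _ ∷ e) = dim e

IsVoxel : ∀ {n} → Cell n → Set
IsVoxel {n} e = dim e ≡ n

infix 4 _Bounds_

_Bounds_ : ∀ {n} → Cell n → Cell n → Set₁
e₁ Bounds e₂ = ⟦ e₁ ⟧ ⊆ ⟦ e₂ ⟧ × dim e₁ ℕ.< dim e₂

Block : ∀ {n} → Cell n → Pred (Cell n) _
Block e v = IsVoxel v × e Bounds v

StrictlyAdjacent : ∀ {n} → ℕ → Cell n → Cell n → Set₁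
StrictlyAdjacent i v₁ v₂ =
  v₁ ≢ v₂ × IsVoxel v₁ × IsVoxel v₂ ×
  ∃[ e ] (dim e ≡ i × ⟦ v₁ ⟧ ∩ ⟦ v₂ ⟧ ≐ ⟦ e ⟧)

-- Only membership in the list is ever used, so order and repetitions are
-- irrelevant.
record DigitalObject (n : ℕ) : Set where
  field
    voxels    : List (Cell n)
    allVoxels : All IsVoxel voxels

module _ {n : ℕ} (D : DigitalObject n) where
  open DigitalObject D

  VoxelOf : Pred (Cell n) 0ℓ
  VoxelOf v = v ∈ voxels

  CellOf : ℕ → Pred (Cell n) _
  CellOf i e = dim e ≡ i × ∃[ v ] (VoxelOf v × ⟦ e ⟧ ⊆ ⟦ v ⟧)

  FreeCell : ℕ → Pred (Cell n) _
  FreeCell i e = CellOf i e × ¬ (Block e ⊆ VoxelOf)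

  -- Holds of e when D has an i-gap over e: i-gaps are counted by their hubs.
  Gap : ℕ → Pred (Cell n) _
  Gap i e = dim e ≡ i × ∃[ v₁ ] ∃[ v₂ ]
    ( (∀ v → (Block e ∩ ∁ VoxelOf) v ⇔ (v ≡ v₁ ⊎ v ≡ v₂))
    × StrictlyAdjacent i v₁ v₂
    × ⟦ v₁ ⟧ ∩ ⟦ v₂ ⟧ ≐ ⟦ e ⟧ )

private variable
  a ℓ : Level
  A : Set a
  P : Pred A ℓ

infix 4 _HasCardinality_

_HasCardinality_ : {A : Set a} → Pred A ℓ → ℕ → Set _
P HasCardinality k =
  ∃[ xs ] (Unique xs × (∀ x → x ∈ xs ⇔ P x) × length xs ≡ k)

HasCardinality-unique : ∀ {k l} → P HasCardinality k → P HasCardinality l → k ≡ l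
HasCardinality-unique (xs , xs! , xs⇔P , refl) (ys , ys! , ys⇔P , refl) =
  ↭-length (∼bag⇒↭ (unique∧set⇒bag xs! ys!
    (λ {x} → record
      { to        = λ m → Equivalence.from (ys⇔P x) (Equivalence.to (xs⇔P x) m)
      ; from      = λ m → Equivalence.from (xs⇔P x) (Equivalence.to (ys⇔P x) m)
      ; to-cong   = λ { refl → refl }
      ; from-cong = λ { refl → refl }
      })))

{-# OPTIONS --safe #-}
module Submission where

-- Count the incidences between free (n-1)-cells c and their faces e.  Such an
-- e is again free, and c has 2 (n-1) of them.  Conversely the four voxels
-- around an (n-2)-cell e form a 2 × 2 square, each coface of e being an edge of
-- the square that is free iff exactly one of its two voxels is in D.  For a
-- free e this happens for two edges, except that it happens for all four when
-- D occupies a diagonal of the square, i.e. has a gap over e.  Hence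
-- 2 (n-1) c*ₙ₋₁ = 2 c*ₙ₋₂ + 2 gₙ₋₂.

open import Defs
open import Data.Bool using (if_then_else_)
open import Data.Fin using (zero; suc)
open import Data.Integer as ℤ using (ℤ; +_; _-_; _*_)
import Data.Integer.Properties as ℤ
open import Data.List using (List; []; _∷_; _++_; map; length; filter; deduplicate; concatMap; cartesianProductWith)
import Data.List.Properties as List
open import Data.List.Membership.Propositional using (_∈_; find; lose)
open import Data.List.Membership.Propositional.Properties
open import Data.List.Relation.Unary.All as All using (All; []; _∷_; all?)
import Data.List.Relation.Unary.All.Properties as All
open import Data.List.Relation.Unary.AllPairs using ([]; _∷_)
open import Data.List.Relation.Unary.Any using (Any; here; there; any?)
open import Data.List.Relation.Unary.Unique.Propositional using (Unique)
import Data.List.Relation.Unary.Unique.Propositional.Properties as Unique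
import Data.List.Relation.Unary.Unique.DecPropositional.Properties as DecUnique
open import Data.Nat as ℕ using (ℕ; zero; suc; _≥_; _∸_; s≤s)
import Data.Nat.Properties as ℕ
open import Data.Nat.ListAction using (sum)
open import Data.Product using (_×_; _,_; proj₁; proj₂; ∃-syntax)
open import Data.Rational as ℚ using (ℚ; ½; 1ℚ)
import Data.Rational.Properties as ℚ
open import Data.Rational.Unnormalised as ℚᵘ using (mkℚᵘ; *≡*; *<*)
import Data.Rational.Unnormalised.Properties as ℚᵘ
open import Data.Sum as Sum using (_⊎_; inj₁; inj₂)
open import Data.Vec using ([]; _∷_; lookup)
import Data.Vec.Properties as Vec
open import Data.Vec.Relation.Binary.Pointwise.Inductive as Pointwise using (Pointwise; []; _∷_)
open import Data.Vec.Relation.Binary.Pointwise.Extensional using (ext; extensional⇒inductive)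
open import Algebra.Properties.CommutativeSemigroup ℕ.+-commutativeSemigroup using (interchange; x∙yz≈y∙xz)
open import Function using (id; _∘_; _⇔_; mk⇔; Equivalence)
open import Level using (Level)
open import Relation.Binary.Definitions using (DecidableEquality; tri<; tri≈; tri>)
open import Relation.Binary.PropositionalEquality
open import Relation.Nullary using (¬_; Dec; does; yes; no; contradiction)
open import Relation.Nullary.Decidable using (map′; _×-dec_; ¬?; decidable-stable)
open import Relation.Unary using (Pred; Decidable; _∩_; _≐_; _⊆_; ∁)

open Equivalence using (to; from)

private variable
  n : ℕ
  α ℓ ℓ′ : Level
  A B : Set α

-- Counting

cardinality-resp-≐ : {P : Pred A ℓ} {Q : Pred A ℓ′} → ∀ {k} → P ≐ Q → P HasCardinality k → Q HasCardinality k
cardinality-resp-≐ (P⊆Q , Q⊆P) (xs , xs! , xs⇔P , len) =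
  xs , xs! , (λ x → mk⇔ (P⊆Q ∘ to (xs⇔P x)) (from (xs⇔P x) ∘ Q⊆P)) , len

list-cardinality : {xs : List A} → Unique xs → (_∈ xs) HasCardinality length xs
list-cardinality {xs = xs} xs! = xs , xs! , (λ _ → mk⇔ id id) , refl

filter-cardinality : {P : Pred A ℓ} {Q : Pred A ℓ′} (Q? : Decidable Q) {xs : List A} →
  Unique xs → (∀ x → x ∈ xs ⇔ P x) → (P ∩ Q) HasCardinality length (filter Q? xs)
filter-cardinality Q? {xs} xs! xs⇔P =
  filter Q? xs , Unique.filter⁺ Q? xs! ,
  (λ x → mk⇔ (λ x∈ → let x∈xs , q = ∈-filter⁻ Q? x∈ in to (xs⇔P x) x∈xs , q)
             (λ (p , q) → ∈-filter⁺ Q? (from (xs⇔P x) p) q)) ,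
  refl

-- The candidate list may repeat elements or contain strangers to `P`; a finite list covering `P` is
-- enough to give it a cardinality. The free cells get theirs this way.
enumerate : DecidableEquality A → {P : Pred A ℓ} → Decidable P →
  (xs : List A) → (∀ {x} → P x → x ∈ xs) → ∃[ k ] P HasCardinality k
enumerate _≟_ P? xs P⊆xs = _ ,
  deduplicate _≟_ (filter P? xs) , DecUnique.deduplicate-! _≟_ (filter P? xs) ,
  (λ x → mk⇔ (λ x∈ → proj₂ (∈-filter⁻ P? {xs = xs} (∈-deduplicate⁻ _≟_ (filter P? xs) x∈)))
             (λ p → ∈-deduplicate⁺ _≟_ (∈-filter⁺ P? (P⊆xs p) p))) ,
  refl

-- Both sides count the related pairs, by rows and by columns. The induction splits the row of `x`
-- off all columns at once.
double-count : {R : A → B → Set ℓ} (R? : ∀ x y → Dec (R x y)) (xs : List A) (ys : List B) →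
  sum (map (λ x → length (filter (R? x) ys)) xs) ≡
  sum (map (λ y → length (filter (λ x → R? x y) xs)) ys)
double-count R? [] []       = refl
double-count R? [] (y ∷ ys) = double-count R? [] ys
double-count R? (x ∷ xs) ys =
  trans (cong (length (filter (R? x) ys) ℕ.+_) (double-count R? xs ys)) (sym (peel ys))
  where
  column : List _ → _ → ℕ
  column zs y = length (filter (λ z → R? z y) zs)
  row total : List _ → ℕ
  row ys   = length (filter (R? x) ys)
  total ys = sum (map (column xs) ys)
  peel : ∀ ys → sum (map (column (x ∷ xs)) ys) ≡ row ys ℕ.+ total ys
  -- This is the inductive step of `peel` with the entry at `x`, `y` set aside; the two outcomes of
  -- `R? x y` then differ only by a leading `suc`.
  swap : ∀ y ys → column xs y ℕ.+ sum (map (column (x ∷ xs)) ys) ≡ row ys ℕ.+ (column xs y ℕ.+ total ys)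
  peel [] = refl
  peel (y ∷ ys) with R? x y
  ... | no _  = swap y ys
  ... | yes _ = cong suc (swap y ys)
  swap y ys = trans (cong (column xs y ℕ.+_) (peel ys)) (x∙yz≈y∙xz (column xs y) (row ys) (total ys))

sum-const : (f : A → ℕ) (k : ℕ) (xs : List A) → (∀ {x} → x ∈ xs → f x ≡ k) →
  sum (map f xs) ≡ length xs ℕ.* k
sum-const f k []       f≡k = refl
sum-const f k (x ∷ xs) f≡k = cong₂ ℕ._+_ (f≡k (here refl)) (sum-const f k xs (f≡k ∘ there))

-- Every entry contributes `k`, and those satisfying `P` contribute `l` on top, so the total splits
-- into the length of the whole list and the count of `P`.
sum-dichotomy : {P : Pred A ℓ} (P? : Decidable P) (f : A → ℕ) (k l : ℕ) (xs : List A) →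
  (∀ {x} → x ∈ xs → P x → f x ≡ k ℕ.+ l) → (∀ {x} → x ∈ xs → ¬ P x → f x ≡ k) →
  sum (map f xs) ≡ length xs ℕ.* k ℕ.+ length (filter P? xs) ℕ.* l
sum-dichotomy P? f k l [] _ _ = refl
sum-dichotomy P? f k l (x ∷ xs) f-yes f-no with P? x
... | no ¬p = trans
  (cong₂ ℕ._+_ (f-no (here refl) ¬p) (sum-dichotomy P? f k l xs (f-yes ∘ there) (f-no ∘ there)))
  (sym (ℕ.+-assoc k _ _))
... | yes p = trans
  (cong₂ ℕ._+_ (f-yes (here refl) p) (sum-dichotomy P? f k l xs (f-yes ∘ there) (f-no ∘ there)))
  (interchange k l _ _)

length-filter-map : {P : Pred B ℓ} (P? : Decidable P) (f : A → B) (xs : List A) →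
  length (filter (P? ∘ f) xs) ≡ length (filter P? (map f xs))
length-filter-map P? f [] = refl
length-filter-map P? f (x ∷ xs) with P? (f x)
... | no _  = length-filter-map P? f xs
... | yes _ = cong suc (length-filter-map P? f xs)

length-filter-∷ : {P : Pred A ℓ} (P? : Decidable P) (x : A) (xs : List A) →
  length (filter P? (x ∷ xs)) ≡ (if does (P? x) then 1 else 0) ℕ.+ length (filter P? xs)
length-filter-∷ P? x xs with P? x
... | no _  = refl
... | yes _ = refl

-- Containment of cells

-- `z / 1` is normalised by a gcd that does not compute for a variable `z`, so order and arithmetic
-- are checked on unnormalised fractions.
toℚᵘ-/1 : ∀ z → ℚ.toℚᵘ (z ℚ./ 1) ℚᵘ.≃ mkℚᵘ z 0
toℚᵘ-/1 z = ℚ.toℚᵘ-fromℚᵘ (mkℚᵘ z 0)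

/1-mono-< : ∀ {x y} → x ℤ.< y → x ℚ./ 1 ℚ.< y ℚ./ 1
/1-mono-< {x} {y} x<y = ℚ.toℚᵘ-cancel-< (begin-strict
  ℚ.toℚᵘ (x ℚ./ 1)  ≃⟨ toℚᵘ-/1 x ⟩
  mkℚᵘ x 0          <⟨ *<* (ℤ.*-monoʳ-<-pos (+ 1) x<y) ⟩
  mkℚᵘ y 0          ≃⟨ toℚᵘ-/1 y ⟨
  ℚ.toℚᵘ (y ℚ./ 1)  ∎)
  where open ℚᵘ.≤-Reasoning

pred-/1 : ∀ z → ℤ.pred z ℚ./ 1 ≡ z ℚ./ 1 ℚ.- 1ℚ
pred-/1 z = ℚ.toℚᵘ-injective (begin
  ℚ.toℚᵘ (ℤ.pred z ℚ./ 1)                  ≈⟨ toℚᵘ-/1 (ℤ.pred z) ⟩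
  mkℚᵘ (ℤ.pred z) 0                        ≈⟨ *≡* (cong (ℤ._* + 1) lemma) ⟩
  mkℚᵘ z 0 ℚᵘ.- ℚᵘ.1ℚᵘ                     ≈⟨ ℚᵘ.+-congˡ (ℚᵘ.- ℚᵘ.1ℚᵘ) (toℚᵘ-/1 z) ⟨
  ℚ.toℚᵘ (z ℚ./ 1) ℚᵘ.- ℚᵘ.1ℚᵘ             ≈⟨ ℚ.toℚᵘ-homo-+ (z ℚ./ 1) (ℚ.- 1ℚ) ⟨
  ℚ.toℚᵘ (z ℚ./ 1 ℚ.- 1ℚ)                  ∎)
  where
  open import Relation.Binary.Reasoning.Setoid ℚᵘ.≃-setoid
  lemma : ℤ.pred z ≡ z ℤ.* + 1 ℤ.+ ℤ.-1ℤ
  lemma = trans (ℤ.+-comm ℤ.-1ℤ z) (cong (ℤ._+ ℤ.-1ℤ) (sym (ℤ.*-identityʳ z)))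

-- Every endpoint of a factor is written as `half z`, which turns comparisons of endpoints into
-- comparisons of integers.
half : ℤ → ℚ
half z = z ℚ./ 1 ℚ.+ ½

half-pred : ∀ z → half (ℤ.pred z) ≡ z ℚ./ 1 ℚ.- ½
half-pred z = trans (cong (ℚ._+ ½) (pred-/1 z)) (ℚ.+-assoc (z ℚ./ 1) (ℚ.- 1ℚ) ½)

half-mono-< : ∀ {x y} → x ℤ.< y → half x ℚ.< half y
half-mono-< x<y = ℚ.+-monoˡ-< ½ (/1-mono-< x<y)

half-cancel-≤ : ∀ {x y} → half x ℚ.≤ half y → x ℤ.≤ y
half-cancel-≤ hx≤hy = ℤ.≮⇒≥ (λ y<x → ℚ.<-irrefl refl (ℚ.<-≤-trans (half-mono-< y<x) hx≤hy))

half-mono-≤ : ∀ {x y} → x ℤ.≤ y → half x ℚ.≤ half y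
half-mono-≤ {x} {y} x≤y with ℤ.<-cmp x y
... | tri< x<y _ _  = ℚ.<⇒≤ (half-mono-< x<y)
... | tri≈ _ refl _ = ℚ.≤-refl
... | tri> _ _ y<x  = contradiction x≤y (ℤ.<⇒≱ y<x)

fromℚ-mono-≤ : ∀ {p q} → p ℚ.≤ q → fromℚ p ≤ fromℚ q
fromℚ-mono-≤ p≤q r<p = ℚ.<-≤-trans r<p p≤q

-- If q < p, then q belongs to the lower cut of p and hence to its own lower cut, which is absurd.
fromℚ-cancel-≤ : ∀ {p q} → fromℚ p ≤ fromℚ q → p ℚ.≤ q
fromℚ-cancel-≤ p⊆q = ℚ.≮⇒≥ (λ q<p → ℚ.<-irrefl refl (p⊆q q<p))

-- The endpoints of a factor are lo f + ½ and hi f + ½.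
lo hi : Factor → ℤ
lo (interval x)  = ℤ.pred x
lo (singleton x) = x
hi (interval x)  = x
hi (singleton x) = x

lo≤hi : ∀ f → lo f ℤ.≤ hi f
lo≤hi (interval x)  = ℤ.i≤j⇒pred[i]≤j ℤ.≤-refl
lo≤hi (singleton x) = ℤ.≤-refl

⟦⟧ᶠ⁺ : ∀ f t → fromℚ (half (lo f)) ≤ t → t ≤ fromℚ (half (hi f)) → ⟦ f ⟧ᶠ t
⟦⟧ᶠ⁺ (interval x) t l u = subst (λ q → fromℚ q ≤ t) (half-pred x) l , u
⟦⟧ᶠ⁺ (singleton x) t l u = u , l

⟦⟧ᶠ⁻ : ∀ f {t} → ⟦ f ⟧ᶠ t → fromℚ (half (lo f)) ≤ t × t ≤ fromℚ (half (hi f))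
⟦⟧ᶠ⁻ (interval x) {t} (l , u) = subst (λ q → fromℚ q ≤ t) (sym (half-pred x)) l , u
⟦⟧ᶠ⁻ (singleton x) (u , l) = l , u

infix 4 _≼ᶠ_ _≼_

-- Inclusion of factors in combinatorial form. The index `suc x` in `lower` arises because the point
-- x + ½ is the left end of the interval around x + 1.
data _≼ᶠ_ : Factor → Factor → Set where
  same  : ∀ {f} → f ≼ᶠ f
  lower : ∀ {x} → singleton x ≼ᶠ interval (ℤ.suc x)
  upper : ∀ {x} → singleton x ≼ᶠ interval x

_≼_ : Cell n → Cell n → Set
_≼_ = Pointwise _≼ᶠ_

≼ᶠ-trans : ∀ {f g h} → f ≼ᶠ g → g ≼ᶠ h → f ≼ᶠ h
≼ᶠ-trans same  q    = q
≼ᶠ-trans lower same = lower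
≼ᶠ-trans upper same = upper

≼ᶠ⇒⊆ : ∀ {f g} → f ≼ᶠ g → ⟦ f ⟧ᶠ ⊆ ⟦ g ⟧ᶠ
≼ᶠ⇒⊆ same t∈f = t∈f
≼ᶠ⇒⊆ (lower {x}) {t} (t≤x , x≤t) = ⟦⟧ᶠ⁺ (interval (ℤ.suc x)) t
  (x≤t ∘ fromℚ-mono-≤ (ℚ.≤-reflexive (cong half (ℤ.pred-suc x))))
  (fromℚ-mono-≤ (half-mono-≤ (ℤ.i≤suc[i] x)) ∘ t≤x)
≼ᶠ⇒⊆ (upper {x}) {t} (t≤x , x≤t) = ⟦⟧ᶠ⁺ (interval x) t
  (x≤t ∘ fromℚ-mono-≤ (half-mono-≤ (lo≤hi (interval x)))) t≤x

endpoints⇒≼ᶠ : ∀ f g → lo g ℤ.≤ lo f → hi f ℤ.≤ hi g → f ≼ᶠ g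
endpoints⇒≼ᶠ (interval x) (interval y) l u
  rewrite ℤ.≤-antisym u (subst₂ ℤ._≤_ (ℤ.suc-pred y) (ℤ.suc-pred x) (ℤ.suc-mono l)) = same
endpoints⇒≼ᶠ (interval x) (singleton y) l u =
  -- An interval does not fit into a point: the hypotheses would give x ≤ x - 1.
  contradiction (ℤ.≤-trans u l) (ℤ.<⇒≱ (ℤ.suc[i]≤j⇒i<j (ℤ.≤-reflexive (ℤ.suc-pred x))))
endpoints⇒≼ᶠ (singleton x) (singleton y) l u rewrite ℤ.≤-antisym u l = same
endpoints⇒≼ᶠ (singleton x) (interval y) l u with ℤ.<-cmp x y
... | tri≈ _ refl _ = upper
... | tri> _ _ y<x  = contradiction u (ℤ.<⇒≱ y<x)
-- From y - 1 ≤ x < y it follows that y = x + 1, so the point is the left end.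
... | tri< x<y _ _
  rewrite ℤ.≤-antisym (subst (ℤ._≤ ℤ.suc x) (ℤ.suc-pred y) (ℤ.suc-mono l)) (ℤ.i<j⇒suc[i]≤j x<y) = lower

≼-refl : {e : Cell n} → e ≼ e
≼-refl = Pointwise.refl same

≼-trans : {e c v : Cell n} → e ≼ c → c ≼ v → e ≼ v
≼-trans = Pointwise.trans ≼ᶠ-trans

≼⇒⊆ : {e c : Cell n} → e ≼ c → ⟦ e ⟧ ⊆ ⟦ c ⟧
≼⇒⊆ e≼c p∈e j = ≼ᶠ⇒⊆ (Pointwise.lookup e≼c j) (p∈e j)

-- It suffices to test the two extreme corners of e.
⊆⇒≼ : (e c : Cell n) → ⟦ e ⟧ ⊆ ⟦ c ⟧ → e ≼ c
⊆⇒≼ e c e⊆c = extensional⇒inductive (ext λ j →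
  endpoints⇒≼ᶠ (lookup e j) (lookup c j)
    (half-cancel-≤ (fromℚ-cancel-≤ (proj₁ (⟦⟧ᶠ⁻ (lookup c j) (e⊆c lo∈e j)))))
    (half-cancel-≤ (fromℚ-cancel-≤ (proj₂ (⟦⟧ᶠ⁻ (lookup c j) (e⊆c hi∈e j))))))
  where
  lo∈e : ⟦ e ⟧ (λ j → fromℚ (half (lo (lookup e j))))
  lo∈e j = ⟦⟧ᶠ⁺ (lookup e j) _ id (fromℚ-mono-≤ (half-mono-≤ (lo≤hi (lookup e j))))
  hi∈e : ⟦ e ⟧ (λ j → fromℚ (half (hi (lookup e j))))
  hi∈e j = ⟦⟧ᶠ⁺ (lookup e j) _ (fromℚ-mono-≤ (half-mono-≤ (lo≤hi (lookup e j)))) id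

-- Dimension and intersections of cells

dim-mono : {e c : Cell n} → e ≼ c → dim e ℕ.≤ dim c
dim-mono []           = ℕ.z≤n
dim-mono (_∷_ {x = interval _}  same  e≼c) = ℕ.s≤s (dim-mono e≼c)
dim-mono (_∷_ {x = singleton _} same  e≼c) = dim-mono e≼c
dim-mono (lower ∷ e≼c) = ℕ.m≤n⇒m≤1+n (dim-mono e≼c)
dim-mono (upper ∷ e≼c) = ℕ.m≤n⇒m≤1+n (dim-mono e≼c)

dim≤n : (e : Cell n) → dim e ℕ.≤ n
dim≤n []                = ℕ.z≤n
dim≤n (interval _ ∷ e)  = ℕ.s≤s (dim≤n e)
dim≤n (singleton _ ∷ e) = ℕ.m≤n⇒m≤1+n (dim≤n e)

-- A common point is at most the right end of the first interval and at least the left end of the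
-- second, and both ends are x + ½.
intervals-meet : ∀ x → ⟦ interval x ⟧ᶠ ∩ ⟦ interval (ℤ.suc x) ⟧ᶠ ≐ ⟦ singleton x ⟧ᶠ
intervals-meet x =
  (λ {t} (t∈l , t∈r) → proj₂ t∈l ,
     proj₁ (⟦⟧ᶠ⁻ (interval (ℤ.suc x)) {t} t∈r) ∘ fromℚ-mono-≤ (ℚ.≤-reflexive (cong half (sym (ℤ.pred-suc x))))) ,
  (λ {t} t∈x → ≼ᶠ⇒⊆ (upper {x}) {t} t∈x , ≼ᶠ⇒⊆ (lower {x}) {t} t∈x)

∷-meet : ∀ {f g h} {v w e : Cell n} →
         ⟦ f ⟧ᶠ ∩ ⟦ g ⟧ᶠ ≐ ⟦ h ⟧ᶠ → ⟦ v ⟧ ∩ ⟦ w ⟧ ≐ ⟦ e ⟧ →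
         ⟦ f ∷ v ⟧ ∩ ⟦ g ∷ w ⟧ ≐ ⟦ h ∷ e ⟧
∷-meet (fg⊆h , h⊆fg) (vw⊆e , e⊆vw) =
  (λ { (pv , pw) zero    → fg⊆h (pv zero , pw zero)
     ; (pv , pw) (suc j) → vw⊆e (pv ∘ suc , pw ∘ suc) j }) ,
  (λ pe → (λ { zero → proj₁ (h⊆fg (pe zero)) ; (suc j) → proj₁ (e⊆vw (pe ∘ suc)) j })
        , (λ { zero → proj₂ (h⊆fg (pe zero)) ; (suc j) → proj₂ (e⊆vw (pe ∘ suc)) j }))

∩-idem-≐ : {P : Pred A ℓ} → P ∩ P ≐ P
∩-idem-≐ = proj₁ , λ p → p , p

∩-comm-≐ : {P Q R : Pred A ℓ} → P ∩ Q ≐ R → Q ∩ P ≐ R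
∩-comm-≐ (to , from) = (λ (q , p) → to (p , q)) , (λ r → proj₂ (from r) , proj₁ (from r))

-- Blocks, cofaces and faces

_≟ᶠ_ : DecidableEquality Factor
interval x  ≟ᶠ interval y  = map′ (cong interval) (λ { refl → refl }) (x ℤ.≟ y)
interval x  ≟ᶠ singleton y = no λ ()
singleton x ≟ᶠ interval y  = no λ ()
singleton x ≟ᶠ singleton y = map′ (cong singleton) (λ { refl → refl }) (x ℤ.≟ y)

_≟ᶜ_ : DecidableEquality (Cell n)
_≟ᶜ_ = Vec.≡-dec _≟ᶠ_

-- Together with `below`, this lists the faces of a cell in all dimensions, so that the free cells
-- of an object are found inside a finite list.
belowᶠ : Factor → List Factor
belowᶠ (interval x)  = interval x ∷ singleton (ℤ.pred x) ∷ singleton x ∷ []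
belowᶠ (singleton x) = singleton x ∷ []

below : Cell n → List (Cell n)
below []      = [] ∷ []
below (f ∷ v) = cartesianProductWith _∷_ (belowᶠ f) (below v)

∈-belowᶠ : ∀ {f g} → f ≼ᶠ g → f ∈ belowᶠ g
∈-belowᶠ {interval _}  same  = here refl
∈-belowᶠ {singleton _} same  = here refl
∈-belowᶠ {singleton x} lower = there (here (cong singleton (sym (ℤ.pred-suc x))))
∈-belowᶠ upper = there (there (here refl))

∈-below : {e v : Cell n} → e ≼ v → e ∈ below v
∈-below []          = here refl
∈-below (f≼g ∷ e≼v) = ∈-cartesianProductWith⁺ _∷_ (∈-belowᶠ f≼g) (∈-below e≼v)

-- The order of the entries matters: `Pair` and `Square` describe `block` and `cofaces` as literal
-- lists.
block cofaces faces : Cell n → List (Cell n)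
block []                = [] ∷ []
block (interval x ∷ e)  = map (interval x ∷_) (block e)
block (singleton x ∷ e) = map (interval x ∷_) (block e) ++ map (interval (ℤ.suc x) ∷_) (block e)
cofaces []                = []
cofaces (interval x ∷ e)  = map (interval x ∷_) (cofaces e)
cofaces (singleton x ∷ e) =
  (interval x ∷ e) ∷ (interval (ℤ.suc x) ∷ e) ∷ map (singleton x ∷_) (cofaces e)
faces []                = []
faces (interval x ∷ e)  =
  (singleton (ℤ.pred x) ∷ e) ∷ (singleton x ∷ e) ∷ map (interval x ∷_) (faces e)
faces (singleton x ∷ e) = map (singleton x ∷_) (faces e)

∈-block⁺ : {e v : Cell n} → IsVoxel v → e ≼ v → v ∈ block e
∈-block⁺ {v = []} vox [] = here refl
∈-block⁺ {v = interval _ ∷ _} vox (same ∷ e≼v) =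
  ∈-map⁺ _ (∈-block⁺ (ℕ.suc-injective vox) e≼v)
∈-block⁺ {v = interval _ ∷ _} vox (_∷_ {xs = e} (lower {x}) e≼v) =
  ∈-++⁺ʳ (map (interval x ∷_) (block e)) (∈-map⁺ _ (∈-block⁺ (ℕ.suc-injective vox) e≼v))
∈-block⁺ {v = interval _ ∷ _} vox (upper ∷ e≼v) =
  ∈-++⁺ˡ (∈-map⁺ _ (∈-block⁺ (ℕ.suc-injective vox) e≼v))
-- A cell with a degenerate factor has dimension below n and is no voxel.
∈-block⁺ {v = singleton _ ∷ v} vox _ = contradiction (ℕ.≤-reflexive (sym vox)) (ℕ.<⇒≱ (ℕ.s≤s (dim≤n v)))

∈-block⁻ : (e : Cell n) {v : Cell n} → v ∈ block e → IsVoxel v × e ≼ v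
∈-block⁻ [] (here refl) = refl , []
∈-block⁻ (interval x ∷ e) v∈ with ∈-map⁻ _ v∈
... | w , w∈ , refl = let vox , e≼w = ∈-block⁻ e w∈ in cong suc vox , same ∷ e≼w
∈-block⁻ (singleton x ∷ e) v∈ with ∈-++⁻ (map (interval x ∷_) (block e)) v∈
... | inj₁ v∈l with w , w∈ , refl ← ∈-map⁻ _ v∈l =
  let vox , e≼w = ∈-block⁻ e w∈ in cong suc vox , upper ∷ e≼w
... | inj₂ v∈r with w , w∈ , refl ← ∈-map⁻ _ v∈r =
  let vox , e≼w = ∈-block⁻ e w∈ in cong suc vox , lower ∷ e≼w

infix 4 _⋖_

-- The covering relation of the face order: exactly one interval is replaced by one of its ends.
-- `faces` lists it downwards and `cofaces` upwards.
data _⋖_ : Cell n → Cell n → Set where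
  lower : ∀ {x} {e : Cell n} → singleton x ∷ e ⋖ interval (ℤ.suc x) ∷ e
  upper : ∀ {x} {e : Cell n} → singleton x ∷ e ⋖ interval x ∷ e
  skip  : ∀ {f} {e c : Cell n} → e ⋖ c → f ∷ e ⋖ f ∷ c

⋖⇒≼ : {e c : Cell n} → e ⋖ c → e ≼ c
⋖⇒≼ lower      = lower ∷ ≼-refl
⋖⇒≼ upper      = upper ∷ ≼-refl
⋖⇒≼ (skip e⋖c) = same ∷ ⋖⇒≼ e⋖c

dim-⋖ : {e c : Cell n} → e ⋖ c → dim c ≡ suc (dim e)
dim-⋖ lower = refl
dim-⋖ upper = refl
dim-⋖ (skip {f = interval _} e⋖c)  = cong suc (dim-⋖ e⋖c)
dim-⋖ (skip {f = singleton _} e⋖c) = dim-⋖ e⋖c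

∈-faces⁺ : {e c : Cell n} → e ⋖ c → e ∈ faces c
∈-faces⁺ (lower {x = x})              = here (cong (λ y → singleton y ∷ _) (sym (ℤ.pred-suc x)))
∈-faces⁺ upper                      = there (here refl)
∈-faces⁺ (skip {f = interval _} e⋖c)  = there (there (∈-map⁺ _ (∈-faces⁺ e⋖c)))
∈-faces⁺ (skip {f = singleton _} e⋖c) = ∈-map⁺ _ (∈-faces⁺ e⋖c)

∈-faces⁻ : (c : Cell n) {e : Cell n} → e ∈ faces c → e ⋖ c
∈-faces⁻ (interval x ∷ c) (here refl) =
  subst (λ y → singleton (ℤ.pred x) ∷ c ⋖ interval y ∷ c) (ℤ.suc-pred x) lower
∈-faces⁻ (interval x ∷ c) (there (here refl)) = upper
∈-faces⁻ (interval x ∷ c) (there (there e∈)) with e , e∈′ , refl ← ∈-map⁻ _ e∈ = skip (∈-faces⁻ c e∈′)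
∈-faces⁻ (singleton x ∷ c) e∈ with e , e∈′ , refl ← ∈-map⁻ _ e∈ = skip (∈-faces⁻ c e∈′)

∈-cofaces⁺ : {e c : Cell n} → e ⋖ c → c ∈ cofaces e
∈-cofaces⁺ lower                        = there (here refl)
∈-cofaces⁺ upper                        = here refl
∈-cofaces⁺ (skip {f = interval _} e⋖c)  = ∈-map⁺ _ (∈-cofaces⁺ e⋖c)
∈-cofaces⁺ (skip {f = singleton _} e⋖c) = there (there (∈-map⁺ _ (∈-cofaces⁺ e⋖c)))

∈-cofaces⁻ : (e : Cell n) {c : Cell n} → c ∈ cofaces e → e ⋖ c
∈-cofaces⁻ (singleton x ∷ e) (here refl)         = upper
∈-cofaces⁻ (singleton x ∷ e) (there (here refl)) = lower
∈-cofaces⁻ (singleton x ∷ e) (there (there c∈)) with c , c∈′ , refl ← ∈-map⁻ _ c∈ = skip (∈-cofaces⁻ e c∈′)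
∈-cofaces⁻ (interval x ∷ e) c∈ with c , c∈′ , refl ← ∈-map⁻ _ c∈ = skip (∈-cofaces⁻ e c∈′)

∉-map-∷ : ∀ {f g} {e : Cell n} (cs : List (Cell n)) → f ≢ g → All (f ∷ e ≢_) (map (g ∷_) cs)
∉-map-∷ cs f≢g = All.map⁺ (All.universal (λ _ → f≢g ∘ Vec.∷-injectiveˡ) cs)

faces-unique : (c : Cell n) → Unique (faces c)
faces-unique [] = []
faces-unique (interval x ∷ c) =
  ((λ eq → ℤ.<-irrefl (lo-injective eq) (ℤ.suc[i]≤j⇒i<j (ℤ.≤-reflexive (ℤ.suc-pred x))))
    ∷ ∉-map-∷ (faces c) (λ ()))
  ∷ ∉-map-∷ (faces c) (λ ())
  ∷ Unique.map⁺ Vec.∷-injectiveʳ (faces-unique c)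
  where
  lo-injective : ∀ {y z} → singleton y ∷ c ≡ singleton z ∷ c → y ≡ z
  lo-injective refl = refl
faces-unique (singleton x ∷ c) = Unique.map⁺ Vec.∷-injectiveʳ (faces-unique c)

cofaces-unique : (e : Cell n) → Unique (cofaces e)
cofaces-unique [] = []
cofaces-unique (singleton x ∷ e) =
  ((λ eq → ℤ.i≢suc[i] (hi-injective eq)) ∷ ∉-map-∷ (cofaces e) (λ ()))
  ∷ ∉-map-∷ (cofaces e) (λ ())
  ∷ Unique.map⁺ Vec.∷-injectiveʳ (cofaces-unique e)
  where
  hi-injective : ∀ {y z} → interval y ∷ e ≡ interval z ∷ e → y ≡ z
  hi-injective refl = refl
cofaces-unique (interval x ∷ e) = Unique.map⁺ Vec.∷-injectiveʳ (cofaces-unique e)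

-- Each interval factor yields two faces, one per end, and each singleton factor yields none.
length-faces : (c : Cell n) → length (faces c) ≡ dim c ℕ.* 2
length-faces [] = refl
length-faces (interval x ∷ c) =
  cong (2 ℕ.+_) (trans (List.length-map _ (faces c)) (length-faces c))
length-faces (singleton x ∷ c) = trans (List.length-map _ (faces c)) (length-faces c)

voxel-block : (e : Cell n) → IsVoxel e → block e ≡ e ∷ []
voxel-block [] _ = refl
voxel-block (interval x ∷ e) vox = cong (map (interval x ∷_)) (voxel-block e (ℕ.suc-injective vox))
voxel-block (singleton x ∷ e) vox = contradiction (ℕ.≤-reflexive (sym vox)) (ℕ.<⇒≱ (ℕ.s≤s (dim≤n e)))

voxel-cofaces : (e : Cell n) → IsVoxel e → cofaces e ≡ []
voxel-cofaces [] _ = refl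
voxel-cofaces (interval x ∷ e) vox = cong (map (interval x ∷_)) (voxel-cofaces e (ℕ.suc-injective vox))
voxel-cofaces (singleton x ∷ e) vox = contradiction (ℕ.≤-reflexive (sym vox)) (ℕ.<⇒≱ (ℕ.s≤s (dim≤n e)))

-- The codimension-one case: the two voxels on either side of an (n-1)-cell are both its block and
-- its cofaces.
record Pair (e : Cell n) : Set₁ where
  field
    {p q}     : Cell n
    block≡    : block e ≡ p ∷ q ∷ []
    cofaces≡  : cofaces e ≡ p ∷ q ∷ []
    p∩q≐e     : ⟦ p ⟧ ∩ ⟦ q ⟧ ≐ ⟦ e ⟧

pair : (e : Cell n) → suc (dim e) ≡ n → Pair e
pair (interval x ∷ e) d = record
  { block≡   = cong (map (interval x ∷_)) block≡
  ; cofaces≡ = cong (map (interval x ∷_)) cofaces≡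
  ; p∩q≐e    = ∷-meet ∩-idem-≐ p∩q≐e
  }
  where open Pair (pair e (ℕ.suc-injective d))
pair (singleton x ∷ e) d = record
  { block≡   = cong (λ vs → map (interval x ∷_) vs ++ map (interval (ℤ.suc x) ∷_) vs) (voxel-block e vox)
  ; cofaces≡ = cong (λ cs → (interval x ∷ e) ∷ (interval (ℤ.suc x) ∷ e) ∷ map (singleton x ∷_) cs)
                    (voxel-cofaces e vox)
  ; p∩q≐e    = ∷-meet (intervals-meet x) ∩-idem-≐
  }
  where vox = ℕ.suc-injective d

-- The four voxels around an (n-2)-cell form a 2 × 2 square with rows a b and
-- c d; its four cofaces separate the horizontal and vertical neighbours.
record Square (e : Cell n) : Set₁ where
  field
    {a b c d}      : Cell n
    block≡         : block e ≡ a ∷ b ∷ c ∷ d ∷ []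
    cofaces-block≡ : map block (cofaces e) ≡
      (a ∷ b ∷ []) ∷ (c ∷ d ∷ []) ∷ (a ∷ c ∷ []) ∷ (b ∷ d ∷ []) ∷ []
    a∩d≐e          : ⟦ a ⟧ ∩ ⟦ d ⟧ ≐ ⟦ e ⟧
    b∩c≐e          : ⟦ b ⟧ ∩ ⟦ c ⟧ ≐ ⟦ e ⟧

-- The recursion runs to the first degenerate factor. The remaining coordinates form a `Pair` there,
-- and its two copies on either side of the degenerate factor are the rows of the square.
square : (e : Cell n) → 2 ℕ.+ dim e ≡ n → Square e
square (interval x ∷ e) dim≡ = record
  { block≡         = cong (map (interval x ∷_)) block≡
  ; cofaces-block≡ = begin
      map block (map (interval x ∷_) (cofaces e))        ≡⟨ List.map-∘ (cofaces e) ⟨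
      -- The two uses of `map-∘` meet because `block (interval x ∷ c)` unfolds to
      -- `map (interval x ∷_) (block c)`.
      map (map (interval x ∷_) ∘ block) (cofaces e)      ≡⟨ List.map-∘ (cofaces e) ⟩
      map (map (interval x ∷_)) (map block (cofaces e))  ≡⟨ cong (map (map (interval x ∷_))) cofaces-block≡ ⟩
      _                                                  ∎
  ; a∩d≐e          = ∷-meet ∩-idem-≐ a∩d≐e
  ; b∩c≐e          = ∷-meet ∩-idem-≐ b∩c≐e
  }
  where
  open Square (square e (ℕ.suc-injective dim≡))
  open ≡-Reasoning
square (singleton x ∷ e) dim≡ = record
  { block≡         = cong stack block≡
  ; cofaces-block≡ = cong₂ _∷_ (cong (map (interval x ∷_)) block≡)
      (cong₂ _∷_ (cong (map (interval (ℤ.suc x) ∷_)) block≡)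
      -- The other two cofaces are `singleton x ∷ p` and `singleton x ∷ q`, whose blocks are the
      -- columns of the square.
      (trans (cong (map block ∘ map (singleton x ∷_)) cofaces≡)
      (cong₂ (λ vs ws → vs ∷ ws ∷ [])
        (cong stack (voxel-block p (voxel (here refl))))
        (cong stack (voxel-block q (voxel (there (here refl))))))))
  ; a∩d≐e          = ∷-meet (intervals-meet x) p∩q≐e
  ; b∩c≐e          = ∷-meet (intervals-meet x) (∩-comm-≐ p∩q≐e)
  }
  where
  open Pair (pair e (ℕ.suc-injective dim≡))
  stack : List (Cell _) → List (Cell _)
  stack vs = map (interval x ∷_) vs ++ map (interval (ℤ.suc x) ∷_) vs
  voxel : ∀ {v} → v ∈ p ∷ q ∷ [] → IsVoxel v
  voxel {v} v∈ = proj₁ (∈-block⁻ e (subst (v ∈_) (sym block≡) v∈))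

∈-block⇒Block : (e : Cell n) {v : Cell n} → dim e ℕ.< n → v ∈ block e → Block e v
∈-block⇒Block e dim<n v∈ =
  let vox , e≼v = ∈-block⁻ e v∈ in vox , ≼⇒⊆ e≼v , subst (dim e ℕ.<_) (sym vox) dim<n

Block⇒∈-block : (e : Cell n) {v : Cell n} → Block e v → v ∈ block e
Block⇒∈-block e {v} (vox , e⊆v , _) = ∈-block⁺ vox (⊆⇒≼ e v e⊆v)

coface-block-⊆ : {e c : Cell n} → e ⋖ c → ∀ {v} → v ∈ block c → v ∈ block e
coface-block-⊆ {c = c} e⋖c v∈ = let vox , c≼v = ∈-block⁻ c v∈ in ∈-block⁺ vox (≼-trans (⋖⇒≼ e⋖c) c≼v)

-- Otherwise c would be contained in v ∩ w, hence in its proper face e.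
coface-separates : {e c v w : Cell n} → e ⋖ c → ⟦ v ⟧ ∩ ⟦ w ⟧ ⊆ ⟦ e ⟧ →
  v ∈ block c → ¬ w ∈ block c
coface-separates {e = e} {c} e⋖c v∩w⊆e v∈ w∈ =
  ℕ.<⇒≱ (ℕ.≤-reflexive (sym (dim-⋖ e⋖c)))
    (dim-mono (⊆⇒≼ c e (λ p∈c → v∩w⊆e (≼⇒⊆ (proj₂ (∈-block⁻ c v∈)) p∈c , ≼⇒⊆ (proj₂ (∈-block⁻ c w∈)) p∈c))))

-- Free cells and gaps

infix 4 _∈ᶠ?_

_∈ᶠ?_ : (e c : Cell n) → Dec (e ∈ faces c)
_∈ᶠ?_ {n} e c = e ∈? faces c
  where open import Data.List.Membership.DecPropositional (_≟ᶜ_ {n}) using (_∈?_)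

-- Equality of unordered pairs, since the two missing voxels of a gap come in either order.
SamePair : {A : Set α} → A → A → A → A → Set α
SamePair v w x y = (v ≡ x × w ≡ y) ⊎ (v ≡ y × w ≡ x)

module _ {n : ℕ} (D : DigitalObject n) where
  open DigitalObject D
  open import Data.List.Membership.DecPropositional (_≟ᶜ_ {n}) using (_∈?_)

  -- Applied to the block of a cell, this is freeness in decidable form: a voxel present makes it a
  -- cell of `D`, and not all being present makes it free.
  Mixed : Pred (List (Cell n)) _
  Mixed vs = Any (VoxelOf D) vs × ¬ All (VoxelOf D) vs

  mixed? : Decidable Mixed
  mixed? vs = any? (_∈? voxels) vs ×-dec ¬? (all? (_∈? voxels) vs)

  Free : ℕ → Pred (Cell n) _
  Free i e = dim e ≡ i × Mixed (block e)

  free? : ∀ i → Decidable (Free i)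
  free? i e = (dim e ℕ.≟ i) ×-dec mixed? (block e)

  -- For an (n-2)-cell, all four edges of its square are mixed. Membership in `D` then alternates
  -- around the square, so `D` occupies exactly one diagonal.
  Full : Pred (Cell n) _
  Full e = All Mixed (map block (cofaces e))

  full? : Decidable Full
  full? e = all? mixed? (map block (cofaces e))

  Mixed-⊆ : ∀ {vs ws} → (∀ {v} → v ∈ vs → v ∈ ws) → Mixed vs → Mixed ws
  Mixed-⊆ vs⊆ws (some , ¬all) =
    (let _ , v∈vs , v∈D = find some in lose (vs⊆ws v∈vs) v∈D) ,
    λ all → ¬all (All.tabulate (All.lookup all ∘ vs⊆ws))

  -- The block of `c` is part of the block of `e`, so presence and absence both carry over. Hence
  -- faces of free cells are free.
  coface-mixed : ∀ {e c} → e ⋖ c → Mixed (block c) → Mixed (block e)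
  coface-mixed e⋖c = Mixed-⊆ (coface-block-⊆ e⋖c)

  -- Inclusion of cells agrees with `≼`, which `block` enumerates. The bound i < n supplies the
  -- strict inequality of dimensions in `Bounds`.
  Free≐FreeCell : ∀ {i} → i ℕ.< n → Free i ≐ FreeCell D i
  Free≐FreeCell {i} i<n =
    (λ { {e} (refl , some , ¬all) →
         let v , v∈block , v∈D = find some in
         (refl , v , v∈D , ≼⇒⊆ (proj₂ (∈-block⁻ e v∈block))) ,
         λ block⊆D → ¬all (All.tabulate (λ {w} w∈ → block⊆D (∈-block⇒Block e i<n w∈))) }) ,
    (λ { {e} ((refl , v , v∈D , e⊆v) , ¬block⊆D) →
         refl ,
         lose (∈-block⁺ (All.lookup allVoxels v∈D) (⊆⇒≼ e v e⊆v)) v∈D ,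
         λ all → ¬block⊆D (λ {w} w∈ → All.lookup all (Block⇒∈-block e w∈)) })

  free-below : ∀ {i e} → Free i e → e ∈ concatMap below voxels
  free-below {e = e} (_ , some , _) =
    let v , v∈block , v∈D = find some
    in ∈-concatMap⁺ below (lose v∈D (∈-below (proj₂ (∈-block⁻ e v∈block))))

  mixed-∈∉ : ∀ {p q} → VoxelOf D p → ¬ VoxelOf D q → Mixed (p ∷ q ∷ [])
  mixed-∈∉ p∈ q∉ = here p∈ , λ { (_ ∷ q∈ ∷ []) → q∉ q∈ }

  mixed-∉∈ : ∀ {p q} → ¬ VoxelOf D p → VoxelOf D q → Mixed (p ∷ q ∷ [])
  mixed-∉∈ p∉ q∈ = there (here q∈) , λ { (p∈ ∷ _) → p∉ p∈ }

  mixed-∈⇒∉ : ∀ {p q} → Mixed (p ∷ q ∷ []) → VoxelOf D p → ¬ VoxelOf D q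
  mixed-∈⇒∉ (_ , ¬all) p∈ q∈ = ¬all (p∈ ∷ q∈ ∷ [])

  mixed-∉⇒∈ : ∀ {p q} → Mixed (p ∷ q ∷ []) → ¬ VoxelOf D p → VoxelOf D q
  mixed-∉⇒∈ (here p∈ , _)         p∉ = contradiction p∈ p∉
  mixed-∉⇒∈ (there (here q∈) , _) p∉ = q∈

  edges : (a b c d : Cell n) → List (List (Cell n))
  edges a b c d = (a ∷ b ∷ []) ∷ (c ∷ d ∷ []) ∷ (a ∷ c ∷ []) ∷ (b ∷ d ∷ []) ∷ []

  -- Around the cycle a, b, d, c membership in `D` changes an even number of times. Zero changes
  -- contradict the mixed block and four contradict the last hypothesis; the sixteen patterns
  -- confirm that two remain.
  count-edges : ∀ a b c d → Mixed (a ∷ b ∷ c ∷ d ∷ []) → ¬ All Mixed (edges a b c d) →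
    length (filter mixed? (edges a b c d)) ≡ 2
  -- The rewriting turns the length into a sum, since filter would hide all
  -- decisions but the first from the with-abstraction.
  count-edges a b c d (some , ¬all) ¬full
    rewrite length-filter-∷ mixed? (a ∷ b ∷ []) ((c ∷ d ∷ []) ∷ (a ∷ c ∷ []) ∷ (b ∷ d ∷ []) ∷ [])
          | length-filter-∷ mixed? (c ∷ d ∷ []) ((a ∷ c ∷ []) ∷ (b ∷ d ∷ []) ∷ [])
          | length-filter-∷ mixed? (a ∷ c ∷ []) ((b ∷ d ∷ []) ∷ [])
          | length-filter-∷ mixed? (b ∷ d ∷ []) []
    with a ∈? voxels | b ∈? voxels | c ∈? voxels | d ∈? voxels
  ... | yes a∈ | yes b∈ | yes c∈ | yes d∈ = contradiction (a∈ ∷ b∈ ∷ c∈ ∷ d∈ ∷ []) ¬all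
  ... | yes a∈ | yes b∈ | yes c∈ | no  d∉ = refl
  ... | yes a∈ | yes b∈ | no  c∉ | yes d∈ = refl
  ... | yes a∈ | yes b∈ | no  c∉ | no  d∉ = refl
  ... | yes a∈ | no  b∉ | yes c∈ | yes d∈ = refl
  ... | yes a∈ | no  b∉ | yes c∈ | no  d∉ = refl
  -- This pattern and its complement below are the diagonals, where every edge is mixed.
  ... | yes a∈ | no  b∉ | no  c∉ | yes d∈ = contradiction
    (mixed-∈∉ a∈ b∉ ∷ mixed-∉∈ c∉ d∈ ∷ mixed-∈∉ a∈ c∉ ∷ mixed-∉∈ b∉ d∈ ∷ []) ¬full
  ... | yes a∈ | no  b∉ | no  c∉ | no  d∉ = refl
  ... | no  a∉ | yes b∈ | yes c∈ | yes d∈ = refl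
  ... | no  a∉ | yes b∈ | yes c∈ | no  d∉ = contradiction
    (mixed-∉∈ a∉ b∈ ∷ mixed-∈∉ c∈ d∉ ∷ mixed-∉∈ a∉ c∈ ∷ mixed-∈∉ b∈ d∉ ∷ []) ¬full
  ... | no  a∉ | yes b∈ | no  c∉ | yes d∈ = refl
  ... | no  a∉ | yes b∈ | no  c∉ | no  d∉ = refl
  ... | no  a∉ | no  b∉ | yes c∈ | yes d∈ = refl
  ... | no  a∉ | no  b∉ | yes c∈ | no  d∉ = refl
  ... | no  a∉ | no  b∉ | no  c∉ | yes d∈ = refl
  ... | no  a∉ | no  b∉ | no  c∉ | no  d∉ with some
  ... | here a∈                         = contradiction a∈ a∉
  ... | there (here b∈)                 = contradiction b∈ b∉
  ... | there (there (here c∈))         = contradiction c∈ c∉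
  ... | there (there (there (here d∈))) = contradiction d∈ d∉

  -- The square around a single (n-2)-cell

  module _ (e : Cell n) (dim≡ : 2 ℕ.+ dim e ≡ n) where
    open Square (square e dim≡)

    Full⇔ : Full e ⇔ All Mixed (edges a b c d)
    Full⇔ = mk⇔ (subst (All Mixed) cofaces-block≡) (subst (All Mixed) (sym cofaces-block≡))

    count-cofaces : length (filter (mixed? ∘ block) (cofaces e)) ≡ length (filter mixed? (edges a b c d))
    count-cofaces = trans (length-filter-map mixed? block (cofaces e)) (cong (length ∘ filter mixed?) cofaces-block≡)

    count-full : Full e → length (filter (mixed? ∘ block) (cofaces e)) ≡ 4
    count-full full = trans count-cofaces (cong length (List.filter-all mixed? (to Full⇔ full)))

    count-not-full : Mixed (block e) → ¬ Full e → length (filter (mixed? ∘ block) (cofaces e)) ≡ 2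
    count-not-full mixed ¬full = trans count-cofaces
      (count-edges a b c d (subst Mixed block≡ mixed) (¬full ∘ from Full⇔))

    dim<n : dim e ℕ.< n
    dim<n = subst (dim e ℕ.<_) dim≡ (ℕ.m≤n⇒m≤1+n ℕ.≤-refl)

    around : ∀ {v} → Block e v → v ∈ a ∷ b ∷ c ∷ d ∷ []
    around {v} v∈ = subst (v ∈_) block≡ (Block⇒∈-block e v∈)

    around⁻ : ∀ {v} → v ∈ a ∷ b ∷ c ∷ d ∷ [] → Block e v
    around⁻ {v} v∈ = ∈-block⇒Block e dim<n (subst (v ∈_) (sym block≡) v∈)

    -- Each edge is the block of a coface of `e`, and two voxels sharing a coface meet in more than
    -- `e`.
    separated : ∀ {v w vs} → ⟦ v ⟧ ∩ ⟦ w ⟧ ⊆ ⟦ e ⟧ → vs ∈ edges a b c d → v ∈ vs → ¬ w ∈ vs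
    separated {vs = vs} v∩w⊆e vs∈ v∈ w∈
      with _ , x∈ , refl ← ∈-map⁻ block (subst (vs ∈_) (sym cofaces-block≡) vs∈)
      = coface-separates (∈-cofaces⁻ e x∈) v∩w⊆e v∈ w∈

    ab∈ : a ∷ b ∷ [] ∈ edges a b c d
    ab∈ = here refl
    cd∈ : c ∷ d ∷ [] ∈ edges a b c d
    cd∈ = there (here refl)
    ac∈ : a ∷ c ∷ [] ∈ edges a b c d
    ac∈ = there (there (here refl))
    bd∈ : b ∷ d ∷ [] ∈ edges a b c d
    bd∈ = there (there (there (here refl)))

    -- Two corners that lie on no common edge are opposite. Equal corners are excluded in the same
    -- way, as each corner lies on an edge.
    diagonal : ∀ {v w} → ⟦ v ⟧ ∩ ⟦ w ⟧ ⊆ ⟦ e ⟧ → v ∈ a ∷ b ∷ c ∷ d ∷ [] → w ∈ a ∷ b ∷ c ∷ d ∷ [] →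
      SamePair v w a d ⊎ SamePair v w b c
    diagonal {v} {w} v∩w⊆e = go
      where
      apart : ∀ {vs} → vs ∈ edges a b c d → v ∈ vs → w ∈ vs → SamePair v w a d ⊎ SamePair v w b c
      apart vs∈ v∈ w∈ = contradiction w∈ (separated v∩w⊆e vs∈ v∈)
      go : v ∈ a ∷ b ∷ c ∷ d ∷ [] → w ∈ a ∷ b ∷ c ∷ d ∷ [] → SamePair v w a d ⊎ SamePair v w b c
      go (here p)                         (here q)                         = apart ab∈ (here p) (here q)
      go (here p)                         (there (here q))                 = apart ab∈ (here p) (there (here q))
      go (here p)                         (there (there (here q)))         = apart ac∈ (here p) (there (here q))
      go (here p)                         (there (there (there (here q)))) = inj₁ (inj₁ (p , q))
      go (there (here p))                 (here q)                         = apart ab∈ (there (here p)) (here q)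
      go (there (here p))                 (there (here q))                 = apart bd∈ (here p) (here q)
      go (there (here p))                 (there (there (here q)))         = inj₂ (inj₁ (p , q))
      go (there (here p))                 (there (there (there (here q)))) = apart bd∈ (here p) (there (here q))
      go (there (there (here p)))         (here q)                         = apart ac∈ (there (here p)) (here q)
      go (there (there (here p)))         (there (here q))                 = inj₂ (inj₂ (p , q))
      go (there (there (here p)))         (there (there (here q)))         = apart cd∈ (here p) (here q)
      go (there (there (here p)))         (there (there (there (here q)))) = apart cd∈ (here p) (there (here q))
      go (there (there (there (here p)))) (here q)                         = inj₁ (inj₂ (p , q))
      go (there (there (there (here p)))) (there (here q))                 = apart bd∈ (there (here p)) (here q)
      go (there (there (there (here p)))) (there (there (here q)))         = apart cd∈ (there (here p)) (here q)
      go (there (there (there (here p)))) (there (there (there (here q)))) = apart bd∈ (there (here p)) (there (here q))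

    -- The missing voxels meet only in `e`, so they are opposite corners; the other two corners are
    -- present, and every edge joins a missing corner to a present one.
    Gap⇒Full : Gap D (dim e) e → Full e
    Gap⇒Full (_ , v , w , missing , _ , v∩w⊆e , _) = from Full⇔ (edges-mixed
      (diagonal v∩w⊆e (around (proj₁ v-missing)) (around (proj₁ w-missing))))
      where
      v-missing : (Block e ∩ ∁ (VoxelOf D)) v
      v-missing = from (missing v) (inj₁ refl)
      w-missing : (Block e ∩ ∁ (VoxelOf D)) w
      w-missing = from (missing w) (inj₂ refl)

      ends : ∀ {x y} → SamePair v w x y → ¬ VoxelOf D x × ¬ VoxelOf D y
      ends (inj₁ (refl , refl)) = proj₂ v-missing , proj₂ w-missing
      ends (inj₂ (refl , refl)) = proj₂ w-missing , proj₂ v-missing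

      -- Were `z` missing, it would be `v` or `w`, and then `ws` or `vs` respectively would contain
      -- both missing voxels, against `separated`.
      between : ∀ {vs ws z} → vs ∈ edges a b c d → ws ∈ edges a b c d → v ∈ vs → w ∈ ws →
        z ∈ vs → z ∈ ws → z ∈ a ∷ b ∷ c ∷ d ∷ [] → VoxelOf D z
      between {z = z} vs∈ ws∈ v∈ w∈ z∈vs z∈ws z∈ = decidable-stable (z ∈? voxels) λ z∉ →
        Sum.[ (λ { refl → separated v∩w⊆e ws∈ z∈ws w∈ })
            , (λ { refl → separated v∩w⊆e vs∈ v∈ z∈vs }) ]
          (to (missing z) (around⁻ z∈ , z∉))

      corner : ∀ {x y vs ws z} → SamePair v w x y → vs ∈ edges a b c d → ws ∈ edges a b c d →
        x ∈ vs → y ∈ ws → z ∈ vs → z ∈ ws → z ∈ a ∷ b ∷ c ∷ d ∷ [] → VoxelOf D z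
      corner (inj₁ (refl , refl)) vs∈ ws∈ x∈ y∈ z∈vs z∈ws = between vs∈ ws∈ x∈ y∈ z∈vs z∈ws
      corner (inj₂ (refl , refl)) vs∈ ws∈ x∈ y∈ z∈vs z∈ws = between ws∈ vs∈ y∈ x∈ z∈ws z∈vs

      edges-mixed : SamePair v w a d ⊎ SamePair v w b c → All Mixed (edges a b c d)
      edges-mixed (inj₁ ad) =
        let a∉ , d∉ = ends ad
            b∈ = corner ad ab∈ bd∈ (here refl) (there (here refl)) (there (here refl)) (here refl) (there (here refl))
            c∈ = corner ad ac∈ cd∈ (here refl) (there (here refl)) (there (here refl)) (here refl) (there (there (here refl)))
        in mixed-∉∈ a∉ b∈ ∷ mixed-∈∉ c∈ d∉ ∷ mixed-∉∈ a∉ c∈ ∷ mixed-∈∉ b∈ d∉ ∷ []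
      edges-mixed (inj₂ bc) =
        let b∉ , c∉ = ends bc
            a∈ = corner bc ab∈ ac∈ (there (here refl)) (there (here refl)) (here refl) (here refl) (here refl)
            d∈ = corner bc bd∈ cd∈ (here refl) (here refl) (there (here refl)) (there (here refl)) (there (there (there (here refl))))
        in mixed-∈∉ a∈ b∉ ∷ mixed-∉∈ c∉ d∈ ∷ mixed-∈∉ a∈ c∉ ∷ mixed-∉∈ b∉ d∈ ∷ []

    gap : ∀ {x y} → x ∈ a ∷ b ∷ c ∷ d ∷ [] → y ∈ a ∷ b ∷ c ∷ d ∷ [] → ¬ VoxelOf D x → ¬ VoxelOf D y →
      (∀ {v} → v ∈ a ∷ b ∷ c ∷ d ∷ [] → ¬ VoxelOf D v → v ≡ x ⊎ v ≡ y) →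
      ⟦ x ⟧ ∩ ⟦ y ⟧ ≐ ⟦ e ⟧ → Gap D (dim e) e
    gap {x} {y} x∈ y∈ x∉ y∉ only x∩y≐e@(x∩y⊆e , _) = refl , x , y ,
      (λ v → mk⇔ (λ (v∈ , v∉) → only (around v∈) v∉)
                 (λ { (inj₁ refl) → around⁻ x∈ , x∉ ; (inj₂ refl) → around⁻ y∈ , y∉ })) ,
      (x≢y , proj₁ (around⁻ x∈) , proj₁ (around⁻ y∈) , e , refl , x∩y≐e) , x∩y≐e
      where
      x≢y : x ≢ y
      -- If the two were equal, the voxel `x` would be contained in `e`, whose dimension is below n.
      x≢y refl = ℕ.<⇒≱ dim<n (subst (ℕ._≤ dim e) (proj₁ (around⁻ x∈))
        (dim-mono (⊆⇒≼ x e (λ p∈x → x∩y⊆e (p∈x , p∈x)))))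

    -- Membership alternates along mixed edges, so `a` decides everything: the missing diagonal is
    -- b, c if `a` is in `D` and a, d otherwise.
    Full⇒Gap : Full e → Gap D (dim e) e
    Full⇒Gap full with to Full⇔ full
    ... | ab ∷ cd ∷ ac ∷ bd ∷ [] with a ∈? voxels
    ... | yes a∈ = gap (there (here refl)) (there (there (here refl))) b∉ (mixed-∈⇒∉ ac a∈)
      (λ { (here refl) v∉ → contradiction a∈ v∉
         ; (there (here eq)) _ → inj₁ eq
         ; (there (there (here eq))) _ → inj₂ eq
         ; (there (there (there (here refl)))) v∉ → contradiction (mixed-∉⇒∈ bd b∉) v∉ })
      b∩c≐e
      where b∉ = mixed-∈⇒∉ ab a∈
    ... | no a∉ = gap (here refl) (there (there (there (here refl)))) a∉ (mixed-∈⇒∉ bd b∈)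
      (λ { (here eq) _ → inj₁ eq
         ; (there (here refl)) v∉ → contradiction b∈ v∉
         ; (there (there (here refl))) v∉ → contradiction (mixed-∉⇒∈ ac a∉) v∉
         ; (there (there (there (here eq)))) _ → inj₂ eq })
      a∩d≐e
      where b∈ = mixed-∉⇒∈ ab a∉

    Full⇒Mixed : Full e → Mixed (block e)
    Full⇒Mixed full with ab ∷ _ ← to Full⇔ full = subst Mixed (sym block≡)
      (Mixed-⊆ (λ { (here eq) → here eq ; (there (here eq)) → there (here eq) }) ab)

  Free∩Full≐Gap : ∀ {i} → 2 ℕ.+ i ≡ n → Free i ∩ Full ≐ Gap D i
  Free∩Full≐Gap {i} eq =
    (λ { {e} ((refl , _) , full) → Full⇒Gap e eq full }) ,
    (λ { {e} g@(refl , _) → let full = Gap⇒Full e eq g in (refl , Full⇒Mixed e eq full) , full })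

  -- Incidences between free cells

  free-face : ∀ {i c e} → Free (suc i) c → e ⋖ c → Free i e
  free-face (dim≡ , mixed) e⋖c =
    ℕ.suc-injective (trans (sym (dim-⋖ e⋖c)) dim≡) , coface-mixed e⋖c mixed

  module _ {i : ℕ} {xs : List (Cell n)} (xs! : Unique xs) where

    -- All faces of a free `c` are free, so the filtered list has the same elements as `faces c`.
    -- Comparing cardinalities ignores the order of the two lists.
    count-faces : (∀ e → e ∈ xs ⇔ Free i e) → ∀ c → Free (suc i) c →
      length (filter (_∈ᶠ? c) xs) ≡ suc i ℕ.* 2
    count-faces xs⇔ c c-free@(dim≡ , _) = trans
      (HasCardinality-unique
        (filter-cardinality (_∈ᶠ? c) xs! xs⇔)
        (cardinality-resp-≐
          ((λ e∈ → free-face c-free (∈-faces⁻ c e∈) , e∈) , proj₂)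
          (list-cardinality (faces-unique c))))
      (trans (length-faces c) (cong (ℕ._* 2) dim≡))

    -- A coface of `e` has the right dimension automatically, so it is free exactly when its block
    -- is mixed. This makes the count local to the square around `e`.
    count-free-cofaces : (∀ c → c ∈ xs ⇔ Free (suc i) c) → ∀ {e} → dim e ≡ i →
      length (filter (e ∈ᶠ?_) xs) ≡ length (filter (mixed? ∘ block) (cofaces e))
    count-free-cofaces xs⇔ {e} dim≡ = HasCardinality-unique
      (filter-cardinality (e ∈ᶠ?_) xs! xs⇔)
      (cardinality-resp-≐
        ((λ {c} (c∈ , mixed) → let e⋖c = ∈-cofaces⁻ e c∈ in
            (trans (dim-⋖ e⋖c) (cong suc dim≡) , mixed) , ∈-faces⁺ e⋖c) ,
         (λ {c} ((_ , mixed) , e∈) → ∈-cofaces⁺ (∈-faces⁻ c e∈) , mixed))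
        (filter-cardinality (mixed? ∘ block) (cofaces-unique e) (λ _ → mk⇔ id id)))

theorem26 : (n : ℕ) → n ≥ 2 → (D : DigitalObject n) →
    ∃[ g ] ∃[ c₁ ] ∃[ c₂ ]
    ( Gap D (n ∸ 2) HasCardinality g
    × FreeCell D (n ∸ 1) HasCardinality c₁
    × FreeCell D (n ∸ 2) HasCardinality c₂
    × + g ≡ + (n ∸ 1) * + c₁ - + c₂ )
theorem26 (suc (suc m)) (s≤s (s≤s _)) D
  with enumerate _≟ᶜ_ (free? D (suc m)) _ (free-below D)
     | enumerate _≟ᶜ_ (free? D m) _ (free-below D)
... | c₁ , card₁@(xs , xs! , xs⇔ , refl) | c₂ , card₂@(ys , ys! , ys⇔ , refl) =
  g , c₁ , c₂ ,
  cardinality-resp-≐ (Free∩Full≐Gap D refl) (filter-cardinality (full? D) ys! ys⇔) ,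
  cardinality-resp-≐ (Free≐FreeCell D ℕ.≤-refl) card₁ ,
  cardinality-resp-≐ (Free≐FreeCell D (ℕ.m≤n⇒m≤1+n ℕ.≤-refl)) card₂ ,
  -- `identity` is an equation of sums in ℕ; the subtraction enters only in ℤ.
  (begin
    + g                                    ≡⟨ cancel (+ g) (+ c₂) ⟨
    + g ℤ.+ + c₂ - + c₂                    ≡⟨ cong (λ k → + k - + c₂) (trans (ℕ.+-comm g c₂) (sym identity)) ⟩
    + (suc m ℕ.* c₁) - + c₂                ≡⟨ cong (_- + c₂) (ℤ.pos-* (suc m) c₁) ⟩
    + suc m * + c₁ - + c₂                  ∎)
  where
  open ≡-Reasoning
  -- Gaps are counted inside the list of free (n-2)-cells, so that `sum-dichotomy` produces this
  -- very number.
  g = length (filter (full? D) ys)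

  cancel : ∀ i j → i ℤ.+ j - j ≡ i
  cancel i j = trans (ℤ.+-assoc i j (ℤ.- j)) (trans (cong (λ k → i ℤ.+ k) (ℤ.+-inverseʳ j)) (ℤ.+-identityʳ i))

  incidences : c₁ ℕ.* (suc m ℕ.* 2) ≡ c₂ ℕ.* 2 ℕ.+ g ℕ.* 2
  incidences = begin
    c₁ ℕ.* (suc m ℕ.* 2)
      ≡⟨ sum-const _ _ xs (λ {c} c∈ → count-faces D ys! ys⇔ c (to (xs⇔ c) c∈)) ⟨
    sum (map (λ c → length (filter (_∈ᶠ? c) ys)) xs)
      ≡⟨ double-count (λ c e → e ∈ᶠ? c) xs ys ⟩
    sum (map (λ e → length (filter (e ∈ᶠ?_) xs)) ys)
      -- Each free `e` has two free cofaces, and a gap over it adds two more.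
      ≡⟨ sum-dichotomy (full? D) _ 2 2 ys
           (λ {e} e∈ full → let dim≡ , _ = to (ys⇔ e) e∈ in
             trans (count-free-cofaces D xs! xs⇔ dim≡) (count-full D e (cong (2 ℕ.+_) dim≡) full))
           (λ {e} e∈ ¬full → let dim≡ , mixed = to (ys⇔ e) e∈ in
             trans (count-free-cofaces D xs! xs⇔ dim≡) (count-not-full D e (cong (2 ℕ.+_) dim≡) mixed ¬full)) ⟩
    c₂ ℕ.* 2 ℕ.+ g ℕ.* 2
      ∎

  identity : suc m ℕ.* c₁ ≡ c₂ ℕ.+ g
  identity = ℕ.*-cancelʳ-≡ _ _ 2 (begin
    suc m ℕ.* c₁ ℕ.* 2     ≡⟨ cong (ℕ._* 2) (ℕ.*-comm (suc m) c₁) ⟩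
    c₁ ℕ.* suc m ℕ.* 2     ≡⟨ ℕ.*-assoc c₁ (suc m) 2 ⟩
    c₁ ℕ.* (suc m ℕ.* 2)   ≡⟨ incidences ⟩
    c₂ ℕ.* 2 ℕ.+ g ℕ.* 2   ≡⟨ ℕ.*-distribʳ-+ 2 c₂ g ⟨
    (c₂ ℕ.+ g) ℕ.* 2       ∎)
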